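{- Let $n\ge 4$ be an integer with $n\equiv 0$ or $1\pmod 4$. For every $\xi\in\mathcal{D}(\mathcal{S}_n)$, the number $lsc(n;\xi)$ of labelled self-complementary graphs $G$ of order $n$ with $|\Gamma(G)|=\xi$ satisfies $$lsc(n;\xi)=|\mathcal{L}_\xi(\mathcal{S}_n)|.$$
   Context: Let $V=\{1,\dots,n\}$ and let $\binom{V}{2}$ be the set of 2-element subsets of $V$; write $ij$ for $\{i,j\}$ with $i<j$. A labelled graph of order $n$ is a pair $G=(V,E)$ with $E\subseteq\binom{V}{2}$; $\overline{G}=(V,\binom{V}{2}\setminus E)$ is its complement. Let $A$ be the symmetric group on $V$. For $\alpha\in A$, $\alpha G$ is the graph on $V$ with edge-set $\{\{\alpha i,\alpha j\}: ij\in E\}$, and $\alpha'$ is the permutation of $\binom{V}{2}$ given by $\alpha'\{i,j\}=\{\alpha i,\alpha j\}$. $\Gamma(G)=\{\alpha\in A:\alpha G=G\}$ is the automorphism group of $G$. $Z(\alpha')$ denotes the set of all cycles (including cycles of length 1) in the disjoint cycle decomposition of $\alpha'$. $G$ is self-complementary if $\alpha G=\overline{G}$ for some $\alpha\in A$; $\mathcal{S}_n$ is the set of all self-complementary labelled graphs on $V$. Put $A_S=\{\alpha\in A:\exists G\in\mathcal{S}_n,\ \alpha G=\overline{G}\}$. Let $\lambda=\binom{n}{2}$, and for $ij\in\binom{V}{2}$ ($i<j$) let $p_{ij}=\frac{(2n-i)(i-1)}{2}+(j-i)$ and $w(ij)=2^{\lambda-p_{ij}}$; $w$ is a bijection from $\binom{V}{2}$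 onto $\{2^0,2^1,\dots,2^{\lambda-1}\}$. For $\alpha\in A_S$, every cycle $z\in Z(\alpha')$ has even length. Write $z=(i_1j_1,i_2j_2,\dots,i_kj_k)$, starting with the element of $z$ at which $w$ is largest, and let $P_1(z)=\{i_1j_1,i_3j_3,\dots,i_{k-1}j_{k-1}\}$ and $P_2(z)=\{i_2j_2,i_4j_4,\dots,i_kj_k\}$. Put $W_1(z)=\sum_{ij\in P_1(z)}w(ij)$, $W_2(z)=\sum_{ij\in P_2(z)}w(ij)$, and define the polynomials $$U_\alpha^{(n)}(x)=\prod_{z\in Z(\alpha')}\bigl(x^{W_1(z)}+x^{W_2(z)}\bigr),\qquad U^{(n)}(x)=\sum_{\alpha\in A_S}U_\alpha^{(n)}(x).$$ Let $d_L$ be the coefficient of $x^L$ in $U^{(n)}(x)$. Put $\mathcal{D}(\mathcal{S}_n)=\{d_L: L\ge 0,\ d_L\ne 0\}$, and for a positive integer $\xi$ put $\mathcal{L}_\xi(\mathcal{S}_n)=\{L: d_L=\xi\}$. -}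

module Defs where

open import Data.Bool.Base using (Bool; true; not)
import Data.Bool.Properties as Bool
open import Data.Empty using (⊥-elim-irr)
open import Data.Fin.Base using (Fin; zero; suc; toℕ; punchIn)
import Data.Fin.Base as Fin
import Data.Fin.Properties as Fin
open import Data.Fin.Permutation using (Permutation′; _⟨$⟩ʳ_; _⟨$⟩ˡ_; inverseˡ; inverseʳ; insert; remove; insert-remove)
import Data.Fin.Permutation as Perm
open import Data.Fin.Subset.Properties using (anySubset?)
open import Data.List.Base hiding (sum)
open import Data.List.Membership.Propositional using (_∈_)
import Data.List.Membership.Setoid.Properties as Membership
open import Data.List.Membership.Propositional.Properties using (∈-allFin; ∈-map⁺; ∈-map⁻; ∈-++⁺ˡ; ∈-++⁺ʳ)
open import Data.List.Relation.Unary.All using (All; all?; [])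
import Data.List.Relation.Unary.All as All
open import Data.List.Relation.Unary.AllPairs using ([]; _∷_)
open import Data.List.Relation.Unary.Any using (index; here)
open import Data.List.Relation.Unary.Any.Properties using (lookup-index)
open import Data.List.Relation.Unary.Enumerates.Setoid using (IsEnumeration)
open import Data.List.Relation.Unary.Unique.Propositional using (Unique)
import Data.List.Relation.Unary.Unique.Propositional.Properties as Unique
import Data.List.Relation.Unary.Unique.Setoid as UniqueS
import Data.List.Relation.Unary.Unique.Setoid.Properties as UniqueS
open import Data.Nat.Base using (ℕ; zero; suc; _+_; _*_; _∸_; _^_; _/_; _≤_; z<s; s<s)
open import Data.Nat.Combinatorics using (_C_)
open import Data.Nat.ListAction using (sum)
import Data.Nat.Properties as ℕ
open import Data.Product.Base using (∃; _×_; _,_; proj₁)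
import Data.Vec.Base as Vec
import Data.Vec.Properties as Vec
open import Function.Base using (_∘_)
open import Function.Bundles using (_↔_; _⇔_; mk⇔; mk↔ₛ′; Inverse; Bijection)
open import Level using (0ℓ)
open import Relation.Binary.Bundles using (Setoid)
open import Relation.Binary.Definitions using (tri<; tri≈; tri>; DecidableEquality)
import Relation.Binary.Construct.On as On
open import Relation.Binary.PropositionalEquality
open import Relation.Nullary.Decidable using (map′; _×-dec_; ¬?)
open import Relation.Nullary.Negation using (¬_)
open import Relation.Unary using (Pred; Decidable)

private
  variable
    n : ℕ

-- S restricted to P; proofs of P are not compared.
_∣_ : (S : Setoid 0ℓ 0ℓ) → Pred (Setoid.Carrier S) 0ℓ → Setoid 0ℓ 0ℓ
S ∣ P = On.setoid {B = ∃ P} S proj₁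

_hasCardinality_ : Setoid 0ℓ 0ℓ → ℕ → Set
S hasCardinality k = Bijection (setoid (Fin k)) S

infix 4 _hasCardinality_ _≐_
infixl 5 _∣_

------------------------------------------------------------------------
-- Two-element subsets {i, j} of V = Fin n, stored as lo < hi

record Edge (n : ℕ) : Set where
  constructor edge
  field
    lo hi  : Fin n
    .lo<hi : lo Fin.< hi

open Edge

_≟ₑ_ : DecidableEquality (Edge n)
edge i j _ ≟ₑ edge k l _ =
  map′ (λ { (refl , refl) → refl }) (λ { refl → refl , refl })
    (i Fin.≟ k ×-dec j Fin.≟ l)

⟪_,_⟫[_] : (i j : Fin n) → .(i ≢ j) → Edge n
⟪ i , j ⟫[ i≢j ] with Fin.<-cmp i j
... | tri< i<j _ _ = edge i j i<j
... | tri≈ _ i≡j _ = ⊥-elim-irr (i≢j i≡j)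
... | tri> _ _ j<i = edge j i j<i

edgeFrom0 : Fin n → Edge (suc n)
edgeFrom0 j = edge zero (suc j) z<s

sucₑ : Edge n → Edge (suc n)
sucₑ (edge i j i<j) = edge (suc i) (suc j) (s<s i<j)

edges : ∀ n → List (Edge n)
edges zero    = []
edges (suc n) = map edgeFrom0 (allFin n) ++ map sucₑ (edges n)

edges-complete : (e : Edge n) → e ∈ edges n
edges-complete {suc n} (edge zero    (suc j) _)   =
  ∈-++⁺ˡ (∈-map⁺ edgeFrom0 (∈-allFin j))
edges-complete {suc n} (edge (suc i) (suc j) i<j) =
  ∈-++⁺ʳ (map edgeFrom0 (allFin n))
    (∈-map⁺ sucₑ (edges-complete (edge i j (ℕ.≤-pred i<j))))

edges-unique : ∀ n → Unique (edges n)
edges-unique zero    = []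
edges-unique (suc n) = Unique.++⁺
  (Unique.map⁺ (λ { refl → refl }) (Unique.allFin⁺ n))
  (Unique.map⁺ (λ { refl → refl }) (edges-unique n))
  disjoint
  where
  disjoint : ∀ {e} → ¬ (e ∈ map edgeFrom0 (allFin n) × e ∈ map sucₑ (edges n))
  disjoint (p , q) with ∈-map⁻ edgeFrom0 p | ∈-map⁻ sucₑ q
  ... | _ , _ , refl | _ , _ , ()

------------------------------------------------------------------------
-- The symmetric group and its action on edges

permSetoid : ℕ → Setoid 0ℓ 0ℓ
permSetoid n = record
  { Carrier       = Permutation′ n
  ; _≈_           = Perm._≈_
  ; isEquivalence = record
    { refl  = λ _ → refl
    ; sym   = λ p i → sym (p i)
    ; trans = λ p q i → trans (p i) (q i)
    }
  }

permutations : ∀ n → List (Permutation′ n)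
permutations zero    = Perm.id ∷ []
permutations (suc n) =
  cartesianProductWith (insert zero) (allFin (suc n)) (permutations n)

insert-cong : ∀ {i j : Fin (suc n)} {π ρ : Permutation′ n} →
              i ≡ j → π Perm.≈ ρ → insert zero i π Perm.≈ insert zero j ρ
insert-cong         refl p zero    = refl
insert-cong {i = i} refl p (suc k) = cong (punchIn i) (p k)

permutations-complete : ∀ n → IsEnumeration (permSetoid n) (permutations n)
permutations-complete zero    π = here λ ()
permutations-complete (suc n) π =
  Membership.∈-resp-≈ (permSetoid (suc n))
    {x = insert zero (π ⟨$⟩ʳ zero) (remove zero π)} {y = π} (insert-remove zero π)
    (Membership.∈-cartesianProductWith⁺
      (setoid _) (permSetoid n) (permSetoid (suc n))
      (λ {_} {_} {π} {ρ} → insert-cong {π = π} {ρ})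
      (∈-allFin (π ⟨$⟩ʳ zero)) (permutations-complete n (remove zero π)))

permutations-unique : ∀ n → UniqueS.Unique (permSetoid n) (permutations n)
permutations-unique zero    = [] ∷ []
permutations-unique (suc n) =
  UniqueS.cartesianProductWith⁺
    (setoid _) (permSetoid n) (permSetoid (suc n)) (insert zero)
    (λ {_} {_} {π} {ρ} → insert-injective π ρ) (Unique.allFin⁺ (suc n)) (permutations-unique n)
  where
  insert-injective : ∀ {i j} (π ρ : Permutation′ n) → insert zero i π Perm.≈ insert zero j ρ →
                     i ≡ j × π Perm.≈ ρ
  insert-injective π ρ p with refl ← p zero =
    refl , λ k → Fin.punchIn-injective _ (π ⟨$⟩ʳ k) (ρ ⟨$⟩ʳ k) (p (suc k))

image : Permutation′ n → Edge n → Edge n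
image α (edge i j i<j) =
  ⟪ α ⟨$⟩ʳ i , α ⟨$⟩ʳ j ⟫[
    (λ αi≡αj → Fin.<⇒≢ i<j
      (trans (sym (inverseˡ α)) (trans (cong (α ⟨$⟩ˡ_) αi≡αj) (inverseˡ α)))) ]

⟪⟫-sorted : ∀ {i j k l : Fin n} .(k<l : k Fin.< l) .{i≢j : i ≢ j} →
            i ≡ k → j ≡ l → ⟪ i , j ⟫[ i≢j ] ≡ edge k l k<l
⟪⟫-sorted {i = i} {j} i<j refl refl with Fin.<-cmp i j
... | tri< _ _ _   = refl
... | tri≈ i≮j _ _ = ⊥-elim-irr (i≮j i<j)
... | tri> i≮j _ _ = ⊥-elim-irr (i≮j i<j)

⟪⟫-reversed : ∀ {i j k l : Fin n} .(k<l : k Fin.< l) .{i≢j : i ≢ j} →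
              i ≡ l → j ≡ k → ⟪ i , j ⟫[ i≢j ] ≡ edge k l k<l
⟪⟫-reversed {i = i} {j} j<i refl refl with Fin.<-cmp i j
... | tri< _ _ j≮i = ⊥-elim-irr (j≮i j<i)
... | tri≈ _ _ j≮i = ⊥-elim-irr (j≮i j<i)
... | tri> _ _ _   = refl

image-inverse : (α β : Permutation′ n) → (∀ i → β ⟨$⟩ʳ (α ⟨$⟩ʳ i) ≡ i) →
                ∀ e → image β (image α e) ≡ e
image-inverse α β βα≡id (edge i j i<j) with Fin.<-cmp (α ⟨$⟩ʳ i) (α ⟨$⟩ʳ j)
... | tri< _ _ _     = ⟪⟫-sorted i<j (βα≡id i) (βα≡id j)
... | tri≈ _ αi≡αj _ = ⊥-elim-irr (Fin.<⇒≢ i<j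
  (trans (sym (βα≡id i)) (trans (cong (β ⟨$⟩ʳ_) αi≡αj) (βα≡id j))))
... | tri> _ _ _     = ⟪⟫-reversed i<j (βα≡id j) (βα≡id i)

_′ : Permutation′ n → Edge n ↔ Edge n
α ′ = mk↔ₛ′ (image α) (image α⁻¹)
  (image-inverse α⁻¹ α λ _ → inverseʳ α)
  (image-inverse α α⁻¹ λ _ → inverseˡ α)
  where α⁻¹ = Perm.flip α

------------------------------------------------------------------------
-- Labelled graphs on V, given by the characteristic function of the edge set

Graph : ℕ → Set
Graph n = Edge n → Bool

_≐_ : Graph n → Graph n → Set
G ≐ H = ∀ e → G e ≡ H e

graphSetoid : ℕ → Setoid 0ℓ 0ℓ
graphSetoid n = Edge n →-setoid Bool

∁ : Graph n → Graph n
∁ G e = not (G e)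

_·_ : Permutation′ n → Graph n → Graph n
(α · G) e = G (Inverse.from (α ′) e)

·-edges : (α : Permutation′ n) (G : Graph n) (e : Edge n) →
          (α · G) e ≡ true ⇔ ∃ λ e₀ → G e₀ ≡ true × e ≡ Inverse.to (α ′) e₀
·-edges α G e = mk⇔
  (λ p → Inverse.from (α ′) e , p , sym (Inverse.strictlyInverseˡ (α ′) e))
  (λ { (e₀ , p , refl) → trans (cong G (Inverse.strictlyInverseʳ (α ′) e₀)) p })

SelfComplementary : Graph n → Set
SelfComplementary G = ∃ λ α → α · G ≐ ∁ G

Γ : Graph n → Setoid 0ℓ 0ℓ
Γ {n} G = permSetoid n ∣ λ α → α · G ≐ G

InA-S : Permutation′ n → Set
InA-S α = ∃ λ G → SelfComplementary G × α · G ≐ ∁ G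

infixr 8 _·_
infix 9 _′

inA-S? : Decidable (InA-S {n})
inA-S? {n} α = map′
  (λ (s , p) → graph s , (α , p) , p)
  (λ (G , _ , p) → Vec.tabulate (G ∘ lookup (edges n)) , λ e →
    trans (graph-tabulate G _) (trans (p e) (cong not (sym (graph-tabulate G e)))))
  (anySubset? λ s → map′
    (λ ps e → All.lookup ps (edges-complete e))
    (λ p → All.tabulate λ {e} _ → p e)
    (all? (λ e → (α · graph s) e Bool.≟ ∁ (graph s) e) (edges n)))
  where
  graph : Vec.Vec Bool (length (edges n)) → Graph n
  graph s e = Vec.lookup s (index (edges-complete e))

  graph-tabulate : ∀ G e → graph (Vec.tabulate (G ∘ lookup (edges n))) e ≡ G e
  graph-tabulate G e = trans
    (Vec.lookup∘tabulate (G ∘ lookup (edges n)) (index (edges-complete e)))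
    (cong G (sym (lookup-index (edges-complete e))))

A-S : ∀ n → List (Permutation′ n)
A-S n = filter inA-S? (permutations n)

------------------------------------------------------------------------
-- Weights

-- Vertices are numbered from 1 here.  The product (2n − i)(i − 1) is even and
-- 1 ≤ p e ≤ n C 2, so neither _/_ nor _∸_ loses anything.
p : Edge n → ℕ
p {n} e = (2 * n ∸ i) * (i ∸ 1) / 2 + (j ∸ i)
  where
  i = suc (toℕ (lo e))
  j = suc (toℕ (hi e))

w : Edge n → ℕ
w {n} e = 2 ^ (n C 2 ∸ p e)

------------------------------------------------------------------------
-- Cycles of α ′

-- e, α′e, α′²e, …, up to but excluding the first return to e.  That return
-- occurs within length (edges n) steps, so the bound cuts nothing off.
cycleFrom : Permutation′ n → Edge n → List (Edge n)
cycleFrom {n} α e =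
  e ∷ takeWhile (λ e₁ → ¬? (e₁ ≟ₑ e))
        (iterate (Inverse.to (α ′)) (Inverse.to (α ′) e) (length (edges n)))

IsHeaviest : Permutation′ n → Edge n → Set
IsHeaviest α e = All (λ e₁ → w e₁ ≤ w e) (cycleFrom α e)

isHeaviest? : (α : Permutation′ n) → Decidable (IsHeaviest α)
isHeaviest? α e = all? (λ e₁ → w e₁ ℕ.≤? w e) (cycleFrom α e)

-- Since w is injective, every cycle, fixed points included, is listed exactly
-- once, written from its heaviest element.
Z : Permutation′ n → List (List (Edge n))
Z {n} α = map (cycleFrom α) (filter (isHeaviest? α) (edges n))

-- P₁ keeps the 1st, 3rd, … entries, P₂ the 2nd, 4th, …
P₁ P₂ : List (Edge n) → List (Edge n)
P₁ []      = []
P₁ (e ∷ z) = e ∷ P₂ z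
P₂ []      = []
P₂ (_ ∷ z) = P₁ z

W₁ W₂ : List (Edge n) → ℕ
W₁ z = sum (map w (P₁ z))
W₂ z = sum (map w (P₂ z))

------------------------------------------------------------------------
-- Polynomials over ℕ: coefficient lists, constant term first

Poly : Set
Poly = List ℕ

infixl 6 _⊕_
infixl 7 _⊗_
infix  8 x^_

_⊕_ : Poly → Poly → Poly
[]      ⊕ g       = g
f       ⊕ []      = f
(a ∷ f) ⊕ (b ∷ g) = a + b ∷ f ⊕ g

_⊗_ : Poly → Poly → Poly
[]      ⊗ g = []
(a ∷ f) ⊗ g = map (a *_) g ⊕ (0 ∷ f ⊗ g)

x^_ : ℕ → Poly
x^ k = replicate k 0 ++ 1 ∷ []

coeff : Poly → ℕ → ℕ
coeff []      _       = 0
coeff (a ∷ _) zero    = a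
coeff (_ ∷ f) (suc k) = coeff f k

Σₚ Πₚ : List Poly → Poly
Σₚ = foldr _⊕_ []
Πₚ = foldr _⊗_ (x^ 0)

Uₐ : Permutation′ n → Poly
Uₐ α = Πₚ (map (λ z → x^ W₁ z ⊕ x^ W₂ z) (Z α))

U : ℕ → Poly
U n = Σₚ (map Uₐ (A-S n))

d : ℕ → ℕ → ℕ
d n L = coeff (U n) L

𝓓 : ℕ → Pred ℕ 0ℓ
𝓓 n ξ = ∃ λ L → d n L ≢ 0 × ξ ≡ d n L

-- Meant for ξ > 0 only: otherwise infinite.
𝓛 : ℕ → ℕ → Setoid 0ℓ 0ℓ
𝓛 n ξ = setoid ℕ ∣ λ L → d n L ≡ ξ

LSC : ℕ → ℕ → Setoid 0ℓ 0ℓ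
LSC n ξ = graphSetoid n ∣ λ G → SelfComplementary G × Γ G hasCardinality ξ

{-# OPTIONS --safe #-}

-- Let weight G be the sum of w over the edges of G.  The weights are distinct
-- powers of two, so a graph is determined by its weight.  If α takes some graph
-- to its complement, then the graphs with αG = ∁G alternate along the cycles of
-- α′ and arise by choosing P₁ or P₂ on each cycle; hence the coefficient of x^L
-- in U_α is 1 if the graph of weight L is one of them and 0 otherwise.  Summing
-- over α, d_L counts the α taking the graph G of weight L to its complement.
-- If there are any, they form a coset of Γ(G), so G ↦ weight G matches the
-- self-complementary graphs with ξ automorphisms with the L such that d_L = ξ.
module Submission where

open import Defs
open import Data.Nat using (ℕ; _≤_; _%_)
open import Data.Product using (∃; _×_)
open import Data.Sum using (_⊎_)
open import Relation.Binary.PropositionalEquality using (_≡_)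
open import Relation.Unary using (_∈_)

open import Data.Bool.Base using (Bool; true; false; not; if_then_else_; _xor_)
import Data.Bool.Properties as Bool
open import Data.Empty using (⊥-elim-irr)
open import Data.Fin.Base using (Fin; zero; suc; toℕ)
open import Data.Fin.Permutation using (Permutation′; _⟨$⟩ʳ_; _⟨$⟩ˡ_; _∘ₚ_; flip; inverseˡ; inverseʳ)
import Data.Fin.Permutation as Perm
import Data.Fin.Properties as Fin
open import Data.List.Base hiding (sum)
open import Data.List.Extrema.Nat using (argmax; argmax-sel; f[xs]≤f[argmax])
open import Data.List.Membership.Propositional using () renaming (_∈_ to _∈ₗ_)
open import Data.List.Membership.Propositional.Properties using (∈-map⁺; ∈-map⁻; ∈-++⁺ˡ; ∈-++⁺ʳ; ∈-filter⁺; ∈-filter⁻; ∈-concat⁺′; ∈-lookup; ∈-upTo⁺)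
open import Data.List.Membership.Propositional.Properties.WithK using (unique∧set⇒bag)
import Data.List.Membership.Setoid as SetoidMembership
import Data.List.Membership.Setoid.Properties as Membershipₛ
import Data.List.Properties as List
open import Data.List.Relation.Binary.BagAndSetEquality using (∼bag⇒↭)
open import Data.List.Relation.Binary.Disjoint.Propositional using (Disjoint)
open import Data.List.Relation.Binary.Permutation.Propositional using (_↭_)
import Data.List.Relation.Binary.Permutation.Propositional.Properties as ↭
open import Data.List.Relation.Unary.All using (All; []; _∷_; all?)
import Data.List.Relation.Unary.All as All
import Data.List.Relation.Unary.All.Properties as All
open import Data.List.Relation.Unary.AllPairs using (AllPairs; []; _∷_)
import Data.List.Relation.Unary.AllPairs.Properties as AllPairs
open import Data.List.Relation.Unary.Any using (here; there; index)
open import Data.List.Relation.Unary.Any.Properties using (lookup-index)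
open import Data.List.Relation.Unary.Unique.Propositional using (Unique)
import Data.List.Relation.Unary.Unique.Propositional.Properties as Unique
import Data.List.Relation.Unary.Unique.Setoid as Uniqueₛ
import Data.List.Relation.Unary.Unique.Setoid.Properties as Uniqueₛ
open import Data.Nat.Base using (zero; suc; _+_; _*_; _∸_; _^_; _/_; _<_; z≤n; s≤s)
open import Data.Nat.Combinatorics using (_C_; nC1≡n; nCk+nC[k+1]≡[n+1]C[k+1])
open import Data.Nat.Divisibility using (divides-refl)
open import Data.Nat.DivMod using (+-distrib-/-∣ʳ; m*n/n≡m)
open import Data.Nat.GeneralisedArithmetic using () renaming (iterate to iter)
open import Data.Nat.ListAction using (sum)
open import Data.Nat.ListAction.Properties using (sum-++; sum-↭)
import Data.Nat.Properties as ℕ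
open import Data.Nat.Tactic.RingSolver using (solve-∀)
open import Data.Product.Base using (_,_; proj₁; proj₂)
open import Data.Sum.Base using (inj₁; inj₂)
open import Data.Unit.Base using (⊤; tt)
open import Data.Vec.Base using (Vec; []; _∷_)
open import Function.Base using (_∘_; id)
open import Function.Bundles using (mk⇔; Inverse; Bijection)
import Function.Construct.Composition as Compose
open import Function.Definitions using (Injective)
open import Function.Properties.Inverse using (Inverse⇒Bijection)
open import Level using (0ℓ)
open import Relation.Binary.Bundles using (Setoid)
open import Relation.Binary.Construct.Closure.ReflexiveTransitive using (Star; ε; _◅_; _◅◅_)
open import Relation.Binary.Definitions using (DecidableEquality; tri<; tri≈; tri>)
open import Relation.Binary.PropositionalEquality using (_≢_; refl; sym; trans; cong; cong₂; subst; ≢-sym; setoid; module ≡-Reasoning)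
open import Relation.Nullary.Decidable using (Dec; yes; no; does; map′; ¬?; decidable-stable)
open import Relation.Nullary.Negation using (¬_; contradiction)
open import Relation.Unary using (Pred; Decidable)

private
  variable
    A B : Set
    n : ℕ

-- Finite sums over lists

∑ : (A → ℕ) → List A → ℕ
∑ g xs = sum (map g xs)

∑-cong : ∀ {g h : A → ℕ} xs → (∀ {x} → x ∈ₗ xs → g x ≡ h x) → ∑ g xs ≡ ∑ h xs
∑-cong []       eq = refl
∑-cong (x ∷ xs) eq = cong₂ _+_ (eq (here refl)) (∑-cong xs (eq ∘ there))

∑-++ : ∀ (g : A → ℕ) xs ys → ∑ g (xs ++ ys) ≡ ∑ g xs + ∑ g ys
∑-++ g xs ys = trans (cong sum (List.map-++ g xs ys)) (sum-++ (map g xs) (map g ys))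

∑-concat-map : ∀ (g : B → ℕ) (f : A → List B) xs → ∑ g (concat (map f xs)) ≡ ∑ (∑ g ∘ f) xs
∑-concat-map g f []       = refl
∑-concat-map g f (x ∷ xs) =
  trans (∑-++ g (f x) (concat (map f xs))) (cong (∑ g (f x) +_) (∑-concat-map g f xs))

∑-map : ∀ (g : B → ℕ) (f : A → B) xs → ∑ g (map f xs) ≡ ∑ (g ∘ f) xs
∑-map g f xs = cong sum (sym (List.map-∘ xs))

∑-↭ : ∀ (g : A → ℕ) {xs ys} → xs ↭ ys → ∑ g xs ≡ ∑ g ys
∑-↭ g p = sum-↭ (↭.map⁺ g p)

∑-zero : ∀ (g : A → ℕ) xs → (∀ {x} → x ∈ₗ xs → g x ≡ 0) → ∑ g xs ≡ 0
∑-zero g []       eq = refl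
∑-zero g (x ∷ xs) eq = cong₂ _+_ (eq (here refl)) (∑-zero g xs (eq ∘ there))

∑-positive : ∀ (g : A → ℕ) xs → ∑ g xs ≢ 0 → ∃ λ x → x ∈ₗ xs × g x ≢ 0
∑-positive g []       s≢0 = contradiction refl s≢0
∑-positive g (x ∷ xs) s≢0 with g x ℕ.≟ 0
... | no gx≢0 = x , here refl , gx≢0
... | yes gx≡0 with y , y∈xs , gy≢0 ← ∑-positive g xs (λ eq → s≢0 (cong₂ _+_ gx≡0 eq))
  = y , there y∈xs , gy≢0

∑-single : ∀ (g : A → ℕ) {x xs} → Unique xs → x ∈ₗ xs → (∀ {y} → y ≢ x → g y ≡ 0) → ∑ g xs ≡ g x
∑-single g {xs = _ ∷ xs} (x∉ ∷ _) (here refl) g≡0 =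
  trans (cong (g _ +_) (∑-zero g xs λ y∈xs → g≡0 (≢-sym (All.lookup x∉ y∈xs)))) (ℕ.+-identityʳ _)
∑-single g {xs = _ ∷ _} (y∉ ∷ xs!) (there x∈xs) g≡0 =
  cong₂ _+_ (g≡0 (All.lookup y∉ x∈xs)) (∑-single g xs! x∈xs g≡0)

∑-indicator : ∀ {P : A → Set} (P? : Decidable P) (g : A → ℕ) xs →
              (∀ {x} → x ∈ₗ xs → P x → g x ≡ 1) → (∀ {x} → x ∈ₗ xs → ¬ P x → g x ≡ 0) →
              ∑ g xs ≡ length (filter P? xs)
∑-indicator P? g []       g≡1 g≡0 = refl
∑-indicator P? g (x ∷ xs) g≡1 g≡0 with P? x
... | yes Px = cong₂ _+_ (g≡1 (here refl) Px) (∑-indicator P? g xs (g≡1 ∘ there) (g≡0 ∘ there))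
... | no ¬Px = cong₂ _+_ (g≡0 (here refl) ¬Px) (∑-indicator P? g xs (g≡1 ∘ there) (g≡0 ∘ there))

-- Superdecreasing sequences

infix 7 _when_

_when_ : ℕ → Bool → ℕ
k when b = if b then k else 0

SuperDecreasing : List ℕ → Set
SuperDecreasing []       = ⊤
SuperDecreasing (k ∷ ks) = sum ks < k × SuperDecreasing ks

∑-when-≤ : ∀ (w : A → ℕ) (G : A → Bool) xs → ∑ (λ x → w x when G x) xs ≤ ∑ w xs
∑-when-≤ w G []       = z≤n
∑-when-≤ w G (x ∷ xs) with G x
... | true  = ℕ.+-monoʳ-≤ (w x) (∑-when-≤ w G xs)
... | false = ℕ.m≤n⇒m≤o+n (w x) (∑-when-≤ w G xs)

-- At the first entry where `G` and `H` differ, one sum contains that weight, while the other is at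
-- most the sum of the later weights, which is smaller.
∑-when-injective : ∀ (w : A → ℕ) {xs} → SuperDecreasing (map w xs) → (G H : A → Bool) →
                   ∑ (λ x → w x when G x) xs ≡ ∑ (λ x → w x when H x) xs →
                   ∀ {x} → x ∈ₗ xs → G x ≡ H x
∑-when-injective w {x ∷ xs} (s<w , sd) G H eq x∈ with G x in Gx | H x in Hx
∑-when-injective w {x ∷ xs} (s<w , sd) G H eq (here refl) | true  | true  = trans Gx (sym Hx)
∑-when-injective w {x ∷ xs} (s<w , sd) G H eq (there x∈)  | true  | true  =
  ∑-when-injective w sd G H (ℕ.+-cancelˡ-≡ (w x) _ _ eq) x∈
∑-when-injective w {x ∷ xs} (s<w , sd) G H eq (here refl) | false | false = trans Gx (sym Hx)
∑-when-injective w {x ∷ xs} (s<w , sd) G H eq (there x∈)  | false | false =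
  ∑-when-injective w sd G H eq x∈
∑-when-injective w {x ∷ xs} (s<w , sd) G H eq _ | true | false =
  contradiction (ℕ.≤-trans (ℕ.m≤m+n (w x) _) (ℕ.≤-trans (ℕ.≤-reflexive eq) (∑-when-≤ w H xs)))
    (ℕ.<⇒≱ s<w)
∑-when-injective w {x ∷ xs} (s<w , sd) G H eq _ | false | true =
  contradiction (ℕ.≤-trans (ℕ.m≤m+n (w x) _) (ℕ.≤-trans (ℕ.≤-reflexive (sym eq)) (∑-when-≤ w G xs)))
    (ℕ.<⇒≱ s<w)

-- With the successor on the left, the geometric sum yields the strict bound `sum … < 2 ^ m` through
-- `≤-reflexive`.
sum-powers : ∀ m → suc (sum (map (2 ^_) (downFrom m))) ≡ 2 ^ m
sum-powers zero    = refl
sum-powers (suc m) = trans (sym (ℕ.+-suc (2 ^ m) _))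
  (cong (2 ^ m +_) (trans (sum-powers m) (sym (ℕ.+-identityʳ _))))

powers-superDecreasing : ∀ m → SuperDecreasing (map (2 ^_) (downFrom m))
powers-superDecreasing zero    = tt
powers-superDecreasing (suc m) = ℕ.≤-reflexive (sum-powers m) , powers-superDecreasing m

powers-unique : ∀ m → Unique (map (2 ^_) (downFrom m))
powers-unique m = subst Unique (sym (List.map-downFrom (2 ^_) m))
  (Unique.applyDownFrom⁺₁ (2 ^_) m λ j<i _ → ≢-sym (ℕ.<⇒≢ (ℕ.^-monoʳ-< 2 (s≤s (s≤s z≤n)) j<i)))

-- The weights of the edges

p-edgeFrom0 : (j : Fin n) → p (edgeFrom0 j) ≡ suc (toℕ j)
p-edgeFrom0 {n} j rewrite ℕ.*-zeroʳ (2 * suc n ∸ 1) = refl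

-- `p` is the position in the lexicographic order, where the `n` edges through `zero` come first. In
-- the formula the numerator grows by `n * 2`, which leaves the floor division exactly, whatever the
-- parity of the rest.
p-sucₑ : (e : Edge n) → p (sucₑ e) ≡ n + p e
p-sucₑ {n} (edge i j _) = begin
  (2 * suc n ∸ suc (suc k)) * suc k / 2 + δ     ≡⟨ cong (λ t → t / 2 + δ) eq ⟩
  (m * k + n * 2) / 2 + δ                       ≡⟨ cong (_+ δ) (+-distrib-/-∣ʳ (m * k) (divides-refl n)) ⟩
  m * k / 2 + n * 2 / 2 + δ                     ≡⟨ cong (λ t → m * k / 2 + t + δ) (m*n/n≡m n 2) ⟩
  m * k / 2 + n + δ                             ≡⟨ cong (_+ δ) (ℕ.+-comm (m * k / 2) n) ⟩
  n + m * k / 2 + δ                             ≡⟨ ℕ.+-assoc n (m * k / 2) δ ⟩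
  n + (m * k / 2 + δ)                           ∎
  where
  open ≡-Reasoning
  k = toℕ i
  m = 2 * n ∸ suc k
  δ = suc (toℕ j) ∸ suc k
  -- This bound keeps the truncated subtractions in `eq` exact.
  1+k≤2n : suc k ≤ 2 * n
  1+k≤2n = ℕ.≤-trans (Fin.toℕ<n i) (ℕ.m≤m+n n _)
  expand : ∀ m k → suc m * suc k ≡ m * k + (m + suc k)
  expand = solve-∀
  eq : (2 * suc n ∸ suc (suc k)) * suc k ≡ m * k + n * 2
  eq = begin
    (2 * suc n ∸ suc (suc k)) * suc k  ≡⟨ cong (λ t → (t ∸ suc (suc k)) * suc k) (ℕ.*-suc 2 n) ⟩
    (2 * n ∸ k) * suc k                ≡⟨ cong (_* suc k) (ℕ.+-∸-assoc 1 1+k≤2n) ⟩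
    suc m * suc k                      ≡⟨ expand m k ⟩
    m * k + (m + suc k)                ≡⟨ cong (m * k +_) (ℕ.m∸n+n≡m 1+k≤2n) ⟩
    m * k + 2 * n                      ≡⟨ cong (m * k +_) (ℕ.*-comm 2 n) ⟩
    m * k + n * 2                      ∎

[1+n]C2≡n+nC2 : ∀ n → suc n C 2 ≡ n + n C 2
[1+n]C2≡n+nC2 n = trans (sym (nCk+nC[k+1]≡[n+1]C[k+1] n 1)) (cong (_+ n C 2) (nC1≡n n))

w-edgeFrom0 : (j : Fin n) → w (edgeFrom0 j) ≡ 2 ^ (n + n C 2 ∸ suc (toℕ j))
w-edgeFrom0 {n} j = cong₂ (λ λ′ q → 2 ^ (λ′ ∸ q)) ([1+n]C2≡n+nC2 n) (p-edgeFrom0 j)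

w-sucₑ : (e : Edge n) → w (sucₑ e) ≡ w e
w-sucₑ {n} e = cong (2 ^_) (trans (cong₂ _∸_ ([1+n]C2≡n+nC2 n) (p-sucₑ e))
  (ℕ.[m+n]∸[m+o]≡n∸o n (n C 2) (p e)))

-- The tabulated block runs from `n + m - 1` down to `m`; these are the exponents of the edges
-- through `zero` when `m` is `n C 2`.
downFrom-+ : ∀ n m → tabulate {n = n} (λ j → n + m ∸ suc (toℕ j)) ++ downFrom m ≡ downFrom (n + m)
downFrom-+ zero    m = refl
downFrom-+ (suc n) m = cong (n + m ∷_) (downFrom-+ n m)

-- `edges` follows the lexicographic order: the edges through `zero` take the top `n` exponents, and
-- `sucₑ` preserves weights. Injectivity of both `w` and `weight` rests on this.
map-w-edges : ∀ n → map w (edges n) ≡ map (2 ^_) (downFrom (n C 2))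
map-w-edges zero    = refl
map-w-edges (suc n) = begin
  map w (map edgeFrom0 (allFin n) ++ map sucₑ (edges n))
    ≡⟨ List.map-++ w (map edgeFrom0 (allFin n)) (map sucₑ (edges n)) ⟩
  map w (map edgeFrom0 (allFin n)) ++ map w (map sucₑ (edges n))
    ≡⟨ cong₂ _++_
         (trans (sym (List.map-∘ (allFin n)))
           (trans (List.map-cong w-edgeFrom0 (allFin n)) (List.map-tabulate id _)))
         (trans (sym (List.map-∘ (edges n))) (trans (List.map-cong w-sucₑ (edges n)) (map-w-edges n))) ⟩
  tabulate (λ j → 2 ^ exponent j) ++ map (2 ^_) (downFrom (n C 2))
    ≡⟨ cong (_++ map (2 ^_) (downFrom (n C 2))) (List.map-tabulate exponent (2 ^_)) ⟨
  map (2 ^_) (tabulate exponent) ++ map (2 ^_) (downFrom (n C 2))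
    ≡⟨ List.map-++ (2 ^_) (tabulate exponent) (downFrom (n C 2)) ⟨
  map (2 ^_) (tabulate exponent ++ downFrom (n C 2))
    ≡⟨ cong (map (2 ^_)) (downFrom-+ n (n C 2)) ⟩
  map (2 ^_) (downFrom (n + n C 2))
    ≡⟨ cong (map (2 ^_) ∘ downFrom) ([1+n]C2≡n+nC2 n) ⟨
  map (2 ^_) (downFrom (suc n C 2)) ∎
  where
  open ≡-Reasoning
  exponent : Fin n → ℕ
  exponent j = n + n C 2 ∸ suc (toℕ j)

Unique-map⇒injective : ∀ {f : A → B} {xs} → Unique (map f xs) →
                       ∀ {x y} → x ∈ₗ xs → y ∈ₗ xs → f x ≡ f y → x ≡ y
Unique-map⇒injective _          (here refl)  (here refl)  eq = refl
Unique-map⇒injective (fx∉ ∷ _)  (here refl)  (there y∈)   eq =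
  contradiction eq (All.lookup fx∉ (∈-map⁺ _ y∈))
Unique-map⇒injective (fy∉ ∷ _)  (there x∈)   (here refl)  eq =
  contradiction (sym eq) (All.lookup fy∉ (∈-map⁺ _ x∈))
Unique-map⇒injective (_ ∷ fxs!) (there x∈)   (there y∈)   eq =
  Unique-map⇒injective fxs! x∈ y∈ eq

w-injective : {e e′ : Edge n} → w e ≡ w e′ → e ≡ e′
w-injective {n} {e} {e′} = Unique-map⇒injective
  (subst Unique (sym (map-w-edges n)) (powers-unique (n C 2)))
  (edges-complete e) (edges-complete e′)

-- The characteristic function along `edges n`, read as a binary numeral with the most significant
-- digit first.
weight : Graph n → ℕ
weight {n} G = ∑ (λ e → w e when G e) (edges n)

weight-injective : {G H : Graph n} → weight G ≡ weight H → G ≐ H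
weight-injective {n} {G} {H} eq e = ∑-when-injective w
  (subst SuperDecreasing (sym (map-w-edges n)) (powers-superDecreasing (n C 2)))
  G H eq (edges-complete e)

weight-cong : {G H : Graph n} → G ≐ H → weight G ≡ weight H
weight-cong {n} eq = ∑-cong (edges n) λ {e} _ → cong (w e when_) (eq e)

-- Cycles of an injection of a finite set into itself

iterate-All : ∀ {f : A → A} → Injective _≡_ _≡_ f → ∀ {x y} r →
              All (_≢ y) (iterate f x r) → All (_≢ f y) (iterate f (f x) r)
iterate-All f-inj zero    []          = []
iterate-All f-inj (suc r) (x≢y ∷ xs≢y) = (x≢y ∘ f-inj) ∷ iterate-All f-inj r xs≢y

-- By injectivity any repetition pulls back to a return to `x`, so it suffices to exclude such
-- returns.
iterate-Unique : ∀ {f : A → A} → Injective _≡_ _≡_ f → ∀ {x} r →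
                 All (_≢ x) (iterate f (f x) r) → Unique (iterate f x (suc r))
iterate-Unique f-inj zero    []            = [] ∷ []
iterate-Unique f-inj (suc r) (fx≢x ∷ ≢x) =
  -- Applying `f` turns avoidance of `x` into avoidance of `f x` one place later; `init` drops the
  -- surplus last entry.
  All.map ≢-sym (fx≢x ∷ ≢x) ∷ iterate-Unique f-inj r (init (iterate-All f-inj (suc r) (fx≢x ∷ ≢x)))
  where
  init : ∀ {P : A → Set} {f : A → A} {x r} → All P (iterate f x (suc r)) → All P (iterate f x r)
  init {r = zero}  _          = []
  init {r = suc r} (Px ∷ Pxs) = Px ∷ init Pxs

iterate-∈-suc : ∀ (f : A → A) x r {y} → y ∈ₗ iterate f x (suc r) →
                y ∈ₗ iterate f x r ⊎ y ≡ iter f x r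
iterate-∈-suc f x zero    (here refl) = inj₂ refl
iterate-∈-suc f x (suc r) (here refl) = inj₁ (here refl)
iterate-∈-suc f x (suc r) (there y∈) with iterate-∈-suc f (f x) r y∈
... | inj₁ y∈′ = inj₁ (there y∈′)
... | inj₂ eq  = inj₂ eq

iterate-∈-shift : ∀ (f : A → A) x r {y} → y ∈ₗ iterate f x r → f y ∈ₗ iterate f (f x) r
iterate-∈-shift f x (suc r) (here refl) = here refl
iterate-∈-shift f x (suc r) (there y∈)  = there (iterate-∈-shift f (f x) r y∈)

iter-suc : ∀ (f : A → A) x r → f (iter f x r) ≡ iter f (f x) r
iter-suc f x zero    = refl
iter-suc f x (suc r) = iter-suc f (f x) r

-- Cancelling `i` applications of `f` leaves a return to `x` after `j - i` steps; counted from
-- `f x`, this is `k = j - i - 1`.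
iter-cancel : ∀ {f : A → A} → Injective _≡_ _≡_ f → ∀ x {i j} → i < j →
              iter f x i ≡ iter f x j → ∃ λ k → k < j × iter f (f x) k ≡ x
iter-cancel f-inj x {zero}  {suc j} _         eq = j , ℕ.≤-refl , sym eq
iter-cancel {f = f} f-inj x {suc i} {suc j} (s≤s i<j) eq
  with k , k<j , eq′ ← iter-cancel f-inj x i<j
         (f-inj (trans (iter-suc f x i) (trans eq (sym (iter-suc f x j)))))
  = k , ℕ.m≤n⇒m≤1+n k<j , eq′

-- Serves to pass from distinct heads to disjoint cycles, which uses that both heads are heaviest.
AllPairs-strengthen : ∀ {P : A → Set} {R S : A → A → Set} → (∀ {x y} → P x → P y → R x y → S x y) →
                      ∀ {xs} → All P xs → AllPairs R xs → AllPairs S xs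
AllPairs-strengthen s []         []         = []
AllPairs-strengthen s (Px ∷ Pxs) (Rx ∷ Rxs) =
  All.zipWith (λ (Py , Rxy) → s Px Py Rxy) (Pxs , Rx) ∷ AllPairs-strengthen s Pxs Rxs

module Cycles {A : Set} (_≟_ : DecidableEquality A) {xs : List A} (xs! : Unique xs) (complete : ∀ x → x ∈ₗ xs)
              {f : A → A} (f-injective : Injective _≡_ _≡_ f) where

  -- `cycleFrom` with `image α` abstracted to `f`, so that `cycleFrom α` is an instance by
  -- computation.
  cycle : A → List A
  cycle x = x ∷ takeWhile (λ y → ¬? (y ≟ x)) (iterate f (f x) (length xs))

  Reaches : A → A → Set
  Reaches = Star λ x y → f x ≡ y

  iter-returns : ∀ x → ∃ λ k → k < length xs × iter f (f x) k ≡ x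
  iter-returns x
    -- The iterates with exponents from 0 to `length xs` outnumber the positions in `xs`, so two of
    -- them coincide.
    with i , j , i<j , eq ← Fin.pigeonhole (ℕ.n<1+n (length xs)) (λ i → index (complete (iter f x (toℕ i))))
    with k , k<j , eq′ ← iter-cancel f-injective x i<j
           (trans (lookup-index (complete _)) (trans (cong (lookup xs) eq) (sym (lookup-index (complete _)))))
    = k , ℕ.<-≤-trans k<j (Fin.toℕ≤pred[n] j) , eq′

  -- Since the return at step `k` lies within the `N` entries, `takeWhile` stops at `x` itself and
  -- not by running out; `r` is the first such step.
  takeWhile-iterate : ∀ {x} N y k → k < N → iter f y k ≡ x → ∃ λ r →
    takeWhile (λ y → ¬? (y ≟ x)) (iterate f y N) ≡ iterate f y r ×
    iter f y r ≡ x × All (_≢ x) (iterate f y r)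
  takeWhile-iterate {x} (suc N) y k k<N eq with y ≟ x
  ... | yes y≡x = 0 , refl , y≡x , []
  takeWhile-iterate {x} (suc N) y zero    k<N       eq | no y≢x = contradiction eq y≢x
  takeWhile-iterate {x} (suc N) y (suc k) (s≤s k<N) eq | no y≢x
    with r , eq₁ , eq₂ , ≢x ← takeWhile-iterate N (f y) k k<N eq
    = suc r , cong (y ∷_) eq₁ , eq₂ , y≢x ∷ ≢x

  -- Replaces the bound `length xs` by the true period `suc r`; facts about the entries of a cycle
  -- are derived from this form.
  cycle-iterate : ∀ x → ∃ λ r →
    cycle x ≡ iterate f x (suc r) × iter f x (suc r) ≡ x × All (_≢ x) (iterate f (f x) r)
  cycle-iterate x
    with k , k<N , eq ← iter-returns x
    with r , eq₁ , eq₂ , ≢x ← takeWhile-iterate (length xs) (f x) k k<N eq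
    = r , cong (x ∷_) eq₁ , eq₂ , ≢x

  cycle-unique : ∀ x → Unique (cycle x)
  cycle-unique x with r , eq , _ , ≢x ← cycle-iterate x rewrite eq = iterate-Unique f-injective r ≢x

  cycle-closed : ∀ {x y} → y ∈ₗ cycle x → f y ∈ₗ cycle x
  cycle-closed {x} y∈ with r , eq , fʳx≡x , _ ← cycle-iterate x rewrite eq
    with iterate-∈-suc f (f x) r (iterate-∈-shift f x (suc r) y∈)
  ... | inj₁ fy∈   = there fy∈
  ... | inj₂ fy≡fʳ = here (trans fy≡fʳ fʳx≡x)

  iter-reaches : ∀ x k → Reaches x (iter f x k)
  iter-reaches x zero    = ε
  iter-reaches x (suc k) = refl ◅ iter-reaches (f x) k

  iterate-reaches : ∀ x r {y} → y ∈ₗ iterate f x r → Reaches x y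
  iterate-reaches x (suc r) (here refl) = ε
  iterate-reaches x (suc r) (there y∈)  = refl ◅ iterate-reaches (f x) r y∈

  -- A step from `x` to `f x` is undone by going on round the cycle until it returns to `x`.
  reaches-sym : ∀ {x y} → Reaches x y → Reaches y x
  reaches-sym ε = ε
  reaches-sym {x} (refl ◅ p) with k , _ , eq ← iter-returns x =
    reaches-sym p ◅◅ subst (Reaches (f x)) eq (iter-reaches (f x) k)

  ∈cycle⇒reaches : ∀ {x y} → y ∈ₗ cycle x → Reaches x y
  ∈cycle⇒reaches {x} y∈ with r , eq , _ ← cycle-iterate x rewrite eq = iterate-reaches x (suc r) y∈

  reaches⇒∈cycle : ∀ {x y} → Reaches x y → y ∈ₗ cycle x
  reaches⇒∈cycle = go (here refl)
    where
    go : ∀ {x y z} → y ∈ₗ cycle x → Reaches y z → z ∈ₗ cycle x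
    go y∈ ε          = y∈
    go y∈ (refl ◅ p) = go (cycle-closed y∈) p

  module Heads {v : A → ℕ} (v-injective : Injective _≡_ _≡_ v) where

    Heaviest : A → Set
    Heaviest x = All (λ y → v y ≤ v x) (cycle x)

    top : A → A
    top x = argmax v x (cycle x)

    top-reaches : ∀ x → Reaches x (top x)
    top-reaches x with argmax-sel v x (cycle x)
    ... | inj₁ eq = subst (Reaches x) (sym eq) ε
    ... | inj₂ ∈c = ∈cycle⇒reaches ∈c

    top-heaviest : ∀ x → Heaviest (top x)
    top-heaviest x = All.tabulate λ y∈ → All.lookup (f[xs]≤f[argmax] {f = v} x (cycle x))
      (reaches⇒∈cycle (top-reaches x ◅◅ ∈cycle⇒reaches y∈))

    -- Each of the two lies on the cycle of the other, so their values bound each other.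
    heaviest-unique : ∀ {x y} → Heaviest x → Heaviest y → Reaches x y → x ≡ y
    heaviest-unique hx hy x⇝y = v-injective (ℕ.≤-antisym
      (All.lookup hy (reaches⇒∈cycle (reaches-sym x⇝y)))
      (All.lookup hx (reaches⇒∈cycle x⇝y)))

    cycles-disjoint : ∀ {x y} → Heaviest x → Heaviest y → x ≢ y → Disjoint (cycle x) (cycle y)
    cycles-disjoint hx hy x≢y (z∈x , z∈y) =
      x≢y (heaviest-unique hx hy (∈cycle⇒reaches z∈x ◅◅ reaches-sym (∈cycle⇒reaches z∈y)))

    -- Makes every function of `top` constant along cycles, which allows whole cycles to be flipped
    -- at once.
    top-f : ∀ x → top (f x) ≡ top x
    top-f x = heaviest-unique (top-heaviest (f x)) (top-heaviest x)
      (reaches-sym (top-reaches (f x)) ◅◅ reaches-sym (refl ◅ ε) ◅◅ top-reaches x)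

    top-heaviest-id : ∀ {x} → Heaviest x → top x ≡ x
    top-heaviest-id {x} hx = sym (heaviest-unique hx (top-heaviest x) (top-reaches x))

    module _ (heaviest? : Decidable Heaviest) where

      -- The decision procedure is a parameter so that `isHeaviest? α` gives exactly the list of
      -- heads inside `Z α`.
      heads : List A
      heads = filter heaviest? xs

      heads-unique : Unique heads
      heads-unique = Unique.filter⁺ heaviest? xs!

      top∈heads : ∀ x → top x ∈ₗ heads
      top∈heads x = ∈-filter⁺ heaviest? (complete (top x)) (top-heaviest x)

      concat-cycles-unique : Unique (concat (map cycle heads))
      concat-cycles-unique = Unique.concat⁺
        (All.map⁺ (All.tabulate λ {x} _ → cycle-unique x))
        (AllPairs.map⁺ (AllPairs-strengthen (λ {x} {y} → cycles-disjoint {x} {y})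
          (All.all-filter heaviest? xs) heads-unique))

      -- Both lists are free of duplicates and contain everything: `x` lies on the cycle of `top x`.
      concat-cycles-↭ : concat (map cycle heads) ↭ xs
      concat-cycles-↭ = ∼bag⇒↭ (unique∧set⇒bag concat-cycles-unique xs! (mk⇔
        (λ _ → complete _)
        (λ _ → ∈-concat⁺′ (reaches⇒∈cycle (reaches-sym (top-reaches _))) (∈-map⁺ cycle (top∈heads _)))))

-- Polynomials

coeff-⊕ : ∀ f g L → coeff (f ⊕ g) L ≡ coeff f L + coeff g L
coeff-⊕ []      g       L       = refl
coeff-⊕ (a ∷ f) []      L       = sym (ℕ.+-identityʳ _)
coeff-⊕ (a ∷ f) (b ∷ g) zero    = refl
coeff-⊕ (a ∷ f) (b ∷ g) (suc L) = coeff-⊕ f g L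

coeff-scale : ∀ a g L → coeff (map (a *_) g) L ≡ a * coeff g L
coeff-scale a []      L       = sym (ℕ.*-zeroʳ a)
coeff-scale a (b ∷ g) zero    = refl
coeff-scale a (b ∷ g) (suc L) = coeff-scale a g L

coeff-∷⊗ : ∀ a f g L → coeff ((a ∷ f) ⊗ g) L ≡ a * coeff g L + coeff (0 ∷ f ⊗ g) L
coeff-∷⊗ a f g L = trans (coeff-⊕ (map (a *_) g) (0 ∷ f ⊗ g) L)
  (cong (_+ coeff (0 ∷ f ⊗ g) L) (coeff-scale a g L))

coeff-⊕⊗ : ∀ f g h L → coeff ((f ⊕ g) ⊗ h) L ≡ coeff (f ⊗ h) L + coeff (g ⊗ h) L
coeff-⊕⊗ []      g       h L = refl
coeff-⊕⊗ (a ∷ f) []      h L = sym (ℕ.+-identityʳ _)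
coeff-⊕⊗ (a ∷ f) (b ∷ g) h L = begin
  coeff ((a + b ∷ f ⊕ g) ⊗ h) L
    ≡⟨ coeff-∷⊗ (a + b) (f ⊕ g) h L ⟩
  (a + b) * coeff h L + coeff (0 ∷ (f ⊕ g) ⊗ h) L
    ≡⟨ cong ((a + b) * coeff h L +_) (shifted L) ⟩
  (a + b) * coeff h L + (coeff (0 ∷ f ⊗ h) L + coeff (0 ∷ g ⊗ h) L)
    ≡⟨ rearrange a b (coeff h L) (coeff (0 ∷ f ⊗ h) L) (coeff (0 ∷ g ⊗ h) L) ⟩
  (a * coeff h L + coeff (0 ∷ f ⊗ h) L) + (b * coeff h L + coeff (0 ∷ g ⊗ h) L)
    ≡⟨ cong₂ _+_ (coeff-∷⊗ a f h L) (coeff-∷⊗ b g h L) ⟨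
  coeff ((a ∷ f) ⊗ h) L + coeff ((b ∷ g) ⊗ h) L ∎
  where
  open ≡-Reasoning
  shifted : ∀ L → coeff (0 ∷ (f ⊕ g) ⊗ h) L ≡ coeff (0 ∷ f ⊗ h) L + coeff (0 ∷ g ⊗ h) L
  shifted zero    = refl
  shifted (suc L) = coeff-⊕⊗ f g h L
  rearrange : ∀ a b c u v → (a + b) * c + (u + v) ≡ (a * c + u) + (b * c + v)
  rearrange = solve-∀

coeff-x^-same : ∀ k → coeff (x^ k) k ≡ 1
coeff-x^-same zero    = refl
coeff-x^-same (suc k) = coeff-x^-same k

coeff-x^-other : ∀ {k L} → k ≢ L → coeff (x^ k) L ≡ 0
coeff-x^-other {zero}  {zero}  k≢L = contradiction refl k≢L
coeff-x^-other {zero}  {suc L} k≢L = refl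
coeff-x^-other {suc k} {zero}  k≢L = refl
coeff-x^-other {suc k} {suc L} k≢L = coeff-x^-other (k≢L ∘ cong suc)

-- Each factor of `x` prepends a zero and so shifts the exponents by one. Equality is
-- coefficientwise because even `x^ 0 ⊗ f` may carry a trailing zero that `f` lacks.
coeff-x^⊗ : ∀ k {f} (deg : A → ℕ) xs → (∀ L → coeff f L ≡ ∑ (λ x → coeff (x^ deg x) L) xs) →
            ∀ L → coeff (x^ k ⊗ f) L ≡ ∑ (λ x → coeff (x^ (k + deg x)) L) xs
coeff-x^⊗ zero {f} deg xs eq L = begin
  coeff (x^ 0 ⊗ f) L                   ≡⟨ coeff-∷⊗ 1 [] f L ⟩
  1 * coeff f L + coeff (0 ∷ []) L     ≡⟨ cong₂ _+_ (ℕ.*-identityˡ _) (coeff-0 L) ⟩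
  coeff f L + 0                        ≡⟨ ℕ.+-identityʳ _ ⟩
  coeff f L                            ≡⟨ eq L ⟩
  ∑ (λ x → coeff (x^ deg x) L) xs      ∎
  where
  open ≡-Reasoning
  coeff-0 : ∀ L → coeff (0 ∷ []) L ≡ 0
  coeff-0 zero    = refl
  coeff-0 (suc L) = refl
coeff-x^⊗ (suc k) {f} deg xs eq zero    =
  trans (coeff-∷⊗ 0 (x^ k) f 0) (sym (∑-zero _ xs λ _ → refl))
coeff-x^⊗ (suc k) {f} deg xs eq (suc L) =
  trans (coeff-∷⊗ 0 (x^ k) f (suc L)) (coeff-x^⊗ k deg xs eq L)

coeff-Σₚ : ∀ (f : A → Poly) xs L → coeff (Σₚ (map f xs)) L ≡ ∑ (λ x → coeff (f x) L) xs
coeff-Σₚ f []       L = refl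
coeff-Σₚ f (x ∷ xs) L =
  trans (coeff-⊕ (f x) (Σₚ (map f xs)) L) (cong (coeff (f x) L +_) (coeff-Σₚ f xs L))

-- Confines the exponents with nonzero coefficient to a finite range, so that `𝓛` can be enumerated.
coeff-bound : ∀ f L → coeff f L ≢ 0 → L < length f
coeff-bound []      L       c≢0 = contradiction refl c≢0
coeff-bound (a ∷ f) zero    c≢0 = s≤s z≤n
coeff-bound (a ∷ f) (suc L) c≢0 = s≤s (coeff-bound f L c≢0)

-- Expansion of a product of binomials

bools : ∀ k → List (Vec Bool k)
bools zero    = [] ∷ []
bools (suc k) = map (true ∷_) (bools k) ++ map (false ∷_) (bools k)

bools-complete : ∀ {k} (cs : Vec Bool k) → cs ∈ₗ bools k
bools-complete []           = here refl
bools-complete (true  ∷ cs) = ∈-++⁺ˡ (∈-map⁺ (true ∷_) (bools-complete cs))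
bools-complete (false ∷ cs) = ∈-++⁺ʳ _ (∈-map⁺ (false ∷_) (bools-complete cs))

bools-unique : ∀ k → Unique (bools k)
bools-unique zero    = [] ∷ []
bools-unique (suc k) = Unique.++⁺
  (Unique.map⁺ (λ { refl → refl }) (bools-unique k))
  (Unique.map⁺ (λ { refl → refl }) (bools-unique k))
  disjoint
  where
  disjoint : ∀ {cs} → ¬ (cs ∈ₗ map (true ∷_) (bools k) × cs ∈ₗ map (false ∷_) (bools k))
  disjoint (p , q) with ∈-map⁻ (true ∷_) p | ∈-map⁻ (false ∷_) q
  ... | _ , _ , refl | _ , _ , ()

restrict : (A → Bool) → (xs : List A) → Vec Bool (length xs)
restrict c []       = []
restrict c (x ∷ xs) = c x ∷ restrict c xs

restrict-cong : ∀ {c c′ : A → Bool} xs → (∀ {x} → x ∈ₗ xs → c x ≡ c′ x) →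
                restrict c xs ≡ restrict c′ xs
restrict-cong []       eq = refl
restrict-cong (x ∷ xs) eq = cong₂ _∷_ (eq (here refl)) (restrict-cong xs (eq ∘ there))

-- A function found for the tail is overridden at the first entry; uniqueness keeps the override
-- away from the tail.
restrict-surjective : DecidableEquality A → ∀ {xs} → Unique xs → (cs : Vec Bool (length xs)) →
                      ∃ λ (c : A → Bool) → restrict c xs ≡ cs
restrict-surjective _≟_ {[]}     []         []       = (λ _ → false) , refl
restrict-surjective _≟_ {x ∷ xs} (x∉ ∷ xs!) (b ∷ cs)
  with c , eq ← restrict-surjective _≟_ xs! cs
  = (λ y → if does (y ≟ x) then b else c y)
  , cong₂ _∷_ at-x (trans (restrict-cong xs λ y∈ → off-x (All.lookup x∉ y∈)) eq)
  where
  at-x : (if does (x ≟ x) then b else c x) ≡ b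
  at-x with x ≟ x
  ... | yes _  = refl
  ... | no x≢x = contradiction refl x≢x
  off-x : ∀ {y} → x ≢ y → (if does (y ≟ x) then b else c y) ≡ c y
  off-x {y} x≢y with y ≟ x
  ... | yes y≡x = contradiction (sym y≡x) x≢y
  ... | no _    = refl

-- The exponent of one term in the expansion of the product of the binomials `x^ a x ⊕ x^ b x`.
total : (a b : A → ℕ) (xs : List A) → Vec Bool (length xs) → ℕ
total a b []       []       = 0
total a b (x ∷ xs) (c ∷ cs) = (if c then a x else b x) + total a b xs cs

total-restrict : ∀ (a b : A → ℕ) c xs →
                 total a b xs (restrict c xs) ≡ ∑ (λ x → if c x then a x else b x) xs
total-restrict a b c []       = refl
total-restrict a b c (x ∷ xs) = cong ((if c x then a x else b x) +_) (total-restrict a b c xs)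

-- The two terms of the first binomial correspond to the two halves of `bools`.
coeff-Πₚ : ∀ (a b : A → ℕ) xs L → coeff (Πₚ (map (λ x → x^ a x ⊕ x^ b x) xs)) L ≡
           ∑ (λ cs → coeff (x^ total a b xs cs) L) (bools (length xs))
coeff-Πₚ a b []       L = sym (ℕ.+-identityʳ _)
coeff-Πₚ a b (x ∷ xs) L = begin
  coeff ((x^ a x ⊕ x^ b x) ⊗ Π) L
    ≡⟨ coeff-⊕⊗ (x^ a x) (x^ b x) Π L ⟩
  coeff (x^ a x ⊗ Π) L + coeff (x^ b x ⊗ Π) L
    ≡⟨ cong₂ _+_ (coeff-x^⊗ (a x) t bs (coeff-Πₚ a b xs) L) (coeff-x^⊗ (b x) t bs (coeff-Πₚ a b xs) L) ⟩
  ∑ (λ cs → coeff (x^ (a x + t cs)) L) bs + ∑ (λ cs → coeff (x^ (b x + t cs)) L) bs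
    ≡⟨ cong₂ _+_ (∑-map g (true ∷_) bs) (∑-map g (false ∷_) bs) ⟨
  ∑ g (map (true ∷_) bs) + ∑ g (map (false ∷_) bs)
    ≡⟨ ∑-++ g (map (true ∷_) bs) (map (false ∷_) bs) ⟨
  ∑ g (bools (suc (length xs))) ∎
  where
  open ≡-Reasoning
  Π  = Πₚ (map (λ x → x^ a x ⊕ x^ b x) xs)
  t  = total a b xs
  bs = bools (length xs)
  g : Vec Bool (suc (length xs)) → ℕ
  g cs = coeff (x^ total a b (x ∷ xs) cs) L

-- Graphs whose complement is their image under α

-- `α · G ≐ ∁ G` stated along `image α`, the direction in which `cycleFrom` runs, instead of its
-- inverse.
Alternating : Permutation′ n → Graph n → Set
Alternating α G = ∀ e → G (image α e) ≡ not (G e)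

≐∁⇒alternating : (α : Permutation′ n) {G : Graph n} → α · G ≐ ∁ G → Alternating α G
≐∁⇒alternating α {G} αG≐∁G e = begin
  G (image α e)              ≡⟨ Bool.not-involutive _ ⟨
  not (not (G (image α e)))  ≡⟨ cong not (αG≐∁G (image α e)) ⟨
  not ((α · G) (image α e))  ≡⟨ cong (not ∘ G) (Inverse.strictlyInverseʳ (α ′) e) ⟩
  not (G e)                  ∎
  where open ≡-Reasoning

alternating⇒≐∁ : (α : Permutation′ n) {G : Graph n} → Alternating α G → α · G ≐ ∁ G
alternating⇒≐∁ α {G} alt e = begin
  (α · G) e                  ≡⟨ Bool.not-involutive _ ⟨
  not (not ((α · G) e))      ≡⟨ cong not (alt (Inverse.from (α ′) e)) ⟨
  not (G (image α (Inverse.from (α ′) e)))  ≡⟨ cong (not ∘ G) (Inverse.strictlyInverseˡ (α ′) e) ⟩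
  not (G e)                  ∎
  where open ≡-Reasoning

image-injective : (α : Permutation′ n) → Injective _≡_ _≡_ (image α)
image-injective α {e} {e′} eq = trans (sym (Inverse.strictlyInverseʳ (α ′) e))
  (trans (cong (Inverse.from (α ′)) eq) (Inverse.strictlyInverseʳ (α ′) e′))

-- The tail starts at an edge of the opposite status, which swaps the two cases just as `P₁` and
-- `P₂` swap in their recursion.
∑-alternating : (α : Permutation′ n) (G : Graph n) → Alternating α G → ∀ e r →
                ∑ (λ e → w e when G e) (iterate (image α) e r) ≡
                (if G e then W₁ (iterate (image α) e r) else W₂ (iterate (image α) e r))
∑-alternating α G alt e zero with G e
... | true  = refl
... | false = refl
∑-alternating α G alt e (suc r) with ih ← ∑-alternating α G alt (image α e) r | G e in Ge
... | true  rewrite alt e | Ge = cong (w e +_) ih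
... | false rewrite alt e | Ge = ih

module _ (α : Permutation′ n) where

  open Cycles {A = Edge n} _≟ₑ_ (edges-unique n) edges-complete (image-injective α)
  open Heads w-injective

  heaviests : List (Edge n)
  heaviests = heads (isHeaviest? α)

  choiceWeight : Vec Bool (length heaviests) → ℕ
  choiceWeight = total (W₁ ∘ cycleFrom α) (W₂ ∘ cycleFrom α) heaviests

  -- The cycles partition the edges, and on each of them the status of the head decides between `W₁`
  -- and `W₂`.
  weight-alternating : ∀ {G} → Alternating α G → weight G ≡ choiceWeight (restrict G heaviests)
  weight-alternating {G} alt = begin
    ∑ g (edges n)                      ≡⟨ ∑-↭ g (concat-cycles-↭ (isHeaviest? α)) ⟨
    ∑ g (concat (Z α))                 ≡⟨ ∑-concat-map g (cycleFrom α) heaviests ⟩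
    ∑ (∑ g ∘ cycleFrom α) heaviests    ≡⟨ ∑-cong heaviests (λ {e} _ → on-cycle e) ⟩
    ∑ (λ e → if G e then W₁ (cycleFrom α e) else W₂ (cycleFrom α e)) heaviests
      ≡⟨ total-restrict _ _ G heaviests ⟨
    choiceWeight (restrict G heaviests) ∎
    where
    open ≡-Reasoning
    g : Edge n → ℕ
    g e = w e when G e
    on-cycle : ∀ e → ∑ g (cycleFrom α e) ≡ (if G e then W₁ (cycleFrom α e) else W₂ (cycleFrom α e))
    on-cycle e with r , eq , _ ← cycle-iterate e =
      subst (λ z → ∑ g z ≡ (if G e then W₁ z else W₂ z)) (sym eq) (∑-alternating α G alt e (suc r))

  -- G₀ is flipped on exactly those cycles whose heaviest edge it decides wrongly.
  restrict-alternating-surjective : ∀ {G₀} → Alternating α G₀ → ∀ cs →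
                                    ∃ λ G → Alternating α G × restrict G heaviests ≡ cs
  restrict-alternating-surjective {G₀} alt₀ cs =
    G , alt , trans (restrict-cong heaviests at-head) (proj₂ choice)
    where
    choice : ∃ λ c → restrict c heaviests ≡ cs
    choice = restrict-surjective _≟ₑ_ (heads-unique (isHeaviest? α)) cs
    c : Edge n → Bool
    c = proj₁ choice
    G : Graph n
    G e = G₀ e xor (G₀ (top e) xor c (top e))
    alt : Alternating α G
    alt e = trans
      (cong₂ (λ b e′ → b xor (G₀ e′ xor c e′)) (alt₀ e) (top-f e))
      (sym (Bool.not-distribˡ-xor (G₀ e) _))
    xor-cancel : ∀ x y → x xor (x xor y) ≡ y
    xor-cancel x y = trans (sym (Bool.xor-assoc x x y)) (cong (_xor y) (Bool.xor-same x))
    at-head : ∀ {e} → e ∈ₗ heaviests → G e ≡ c e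
    at-head {e} e∈ = trans
      (cong (λ e′ → G₀ e xor (G₀ e′ xor c e′))
        (top-heaviest-id (proj₂ (∈-filter⁻ (isHeaviest? α) {xs = edges n} e∈))))
      (xor-cancel (G₀ e) (c e))

  -- Every choice comes from an alternating graph, which its weight determines. Hence no two terms
  -- in the expansion of `Uₐ α` share an exponent.
  choiceWeight-injective : ∀ {G₀} → Alternating α G₀ → Injective _≡_ _≡_ choiceWeight
  choiceWeight-injective alt₀ {cs} {cs′} eq =
    let G  , alt  , G≡cs   = restrict-alternating-surjective alt₀ cs
        G′ , alt′ , G′≡cs′ = restrict-alternating-surjective alt₀ cs′
        G≐G′ = weight-injective {G = G} {G′} (begin
          weight G                               ≡⟨ weight-alternating alt ⟩
          choiceWeight (restrict G heaviests)    ≡⟨ cong choiceWeight G≡cs ⟩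
          choiceWeight cs                        ≡⟨ eq ⟩
          choiceWeight cs′                       ≡⟨ cong choiceWeight G′≡cs′ ⟨
          choiceWeight (restrict G′ heaviests)   ≡⟨ weight-alternating alt′ ⟨
          weight G′                              ∎)
    in trans (sym G≡cs) (trans (restrict-cong heaviests λ {e} _ → G≐G′ e) G′≡cs′)
    where open ≡-Reasoning

  coeff-Uₐ : ∀ L → coeff (Uₐ α) L ≡ ∑ (λ cs → coeff (x^ choiceWeight cs) L) (bools (length heaviests))
  coeff-Uₐ L = trans (cong (λ fs → coeff (Πₚ fs) L) (sym (List.map-∘ heaviests)))
    (coeff-Πₚ (W₁ ∘ cycleFrom α) (W₂ ∘ cycleFrom α) heaviests L)

  -- Only the choice read off from `G` has exponent `weight G`.
  coeff-Uₐ-weight : ∀ {G} → Alternating α G → coeff (Uₐ α) (weight G) ≡ 1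
  coeff-Uₐ-weight {G} alt = begin
    coeff (Uₐ α) (weight G)
      ≡⟨ coeff-Uₐ (weight G) ⟩
    ∑ (λ cs → coeff (x^ choiceWeight cs) (weight G)) (bools (length heaviests))
      ≡⟨ ∑-single _ (bools-unique _) (bools-complete (restrict G heaviests))
           (λ cs≢ → coeff-x^-other (λ eq → cs≢
             (choiceWeight-injective alt (trans eq (weight-alternating alt))))) ⟩
    coeff (x^ choiceWeight (restrict G heaviests)) (weight G)
      ≡⟨ cong (λ k → coeff (x^ k) (weight G)) (weight-alternating alt) ⟨
    coeff (x^ weight G) (weight G)
      ≡⟨ coeff-x^-same (weight G) ⟩
    1 ∎
    where open ≡-Reasoning

  coeff-Uₐ≢0 : ∀ {G₀} → Alternating α G₀ → ∀ {L} → coeff (Uₐ α) L ≢ 0 →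
               ∃ λ G → Alternating α G × weight G ≡ L
  coeff-Uₐ≢0 alt₀ {L} c≢0 =
    let cs , _ , cs≢0    = ∑-positive _ (bools (length heaviests)) (subst (_≢ 0) (coeff-Uₐ L) c≢0)
        G , alt , G≡cs = restrict-alternating-surjective alt₀ cs
    in G , alt , trans (weight-alternating alt) (trans (cong choiceWeight G≡cs)
         (decidable-stable (choiceWeight cs ℕ.≟ L) (cs≢0 ∘ coeff-x^-other)))

-- The coefficients of `U` as counts of complementing permutations

d-∑ : ∀ n L → d n L ≡ ∑ (λ α → coeff (Uₐ α) L) (A-S n)
d-∑ n = coeff-Σₚ Uₐ (A-S n)

∈A-S⇒InA-S : {α : Permutation′ n} → α ∈ₗ A-S n → InA-S α
∈A-S⇒InA-S α∈ = All.lookup (All.all-filter inA-S? (permutations _)) α∈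

d≢0⇒weight : ∀ {n L} → d n L ≢ 0 → ∃ λ (G : Graph n) → SelfComplementary G × weight G ≡ L
d≢0⇒weight {n} {L} d≢0 =
  let α , α∈ , c≢0        = ∑-positive _ (A-S n) (subst (_≢ 0) (d-∑ n L) d≢0)
      G₀ , _ , αG₀≐∁G₀ = ∈A-S⇒InA-S α∈
      G , alt , eq       = coeff-Uₐ≢0 α (≐∁⇒alternating α αG₀≐∁G₀) c≢0
  in G , (α , alternating⇒≐∁ α alt) , eq

_·_≐∁? : (α : Permutation′ n) (G : Graph n) → Dec (α · G ≐ ∁ G)
α · G ≐∁? = map′
  (λ ps e → All.lookup ps (edges-complete e))
  (λ p → All.tabulate λ {e} _ → p e)
  (all? (λ e → (α · G) e Bool.≟ ∁ G e) (edges _))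

-- Filters `A-S n`, the range of the sum in `d-∑`; `complementing-complete` shows that no
-- complementing permutation is missed.
complementing : Graph n → List (Permutation′ n)
complementing {n} G = filter (_· G ≐∁?) (A-S n)

d-weight : (G : Graph n) → d n (weight G) ≡ length (complementing G)
d-weight {n} G = trans (d-∑ n (weight G)) (∑-indicator (_· G ≐∁?) _ (A-S n)
  (λ {α} _ αG≐∁G → coeff-Uₐ-weight α (≐∁⇒alternating α αG≐∁G))
  coeff≡0)
  where
  -- A nonzero coefficient would give an alternating graph of the same weight as `G`, hence `G`
  -- itself.
  coeff≡0 : ∀ {α} → α ∈ₗ A-S n → ¬ (α · G ≐ ∁ G) → coeff (Uₐ α) (weight G) ≡ 0
  coeff≡0 {α} α∈ αG≢∁G = decidable-stable (coeff (Uₐ α) (weight G) ℕ.≟ 0) λ c≢0 →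
    let G₀ , _ , αG₀≐∁G₀ = ∈A-S⇒InA-S α∈
        G′ , alt , eq  = coeff-Uₐ≢0 α (≐∁⇒alternating α αG₀≐∁G₀) c≢0
        G′≐G           = weight-injective {G = G′} {G} eq
    in αG≢∁G (alternating⇒≐∁ α λ e → trans (sym (G′≐G (image α e)))
         (trans (alt e) (cong not (G′≐G e))))

-- Counting automorphisms

⟪⟫-swap : (i j : Fin n) .{i≢j : i ≢ j} .{j≢i : j ≢ i} → ⟪ i , j ⟫[ i≢j ] ≡ ⟪ j , i ⟫[ j≢i ]
⟪⟫-swap i j {i≢j} with Fin.<-cmp i j
... | tri< i<j _ _ = sym (⟪⟫-reversed i<j refl refl)
... | tri≈ _ i≡j _ = ⊥-elim-irr (i≢j i≡j)
... | tri> _ _ j<i = sym (⟪⟫-sorted j<i refl refl)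

⟪⟫-cong : ∀ {i j k l : Fin n} .{i≢j : i ≢ j} .{k≢l : k ≢ l} → i ≡ k → j ≡ l →
          ⟪ i , j ⟫[ i≢j ] ≡ ⟪ k , l ⟫[ k≢l ]
⟪⟫-cong refl refl = refl

image-cong : ∀ {α β : Permutation′ n} → α Perm.≈ β → ∀ e → image α e ≡ image β e
image-cong α≈β (edge i j _) = ⟪⟫-cong (α≈β i) (α≈β j)


image-∘ : (α β : Permutation′ n) → ∀ e → image (α ∘ₚ β) e ≡ image β (image α e)
image-∘ α β (edge i j i<j) with Fin.<-cmp (α ⟨$⟩ʳ i) (α ⟨$⟩ʳ j)
... | tri< _ _ _     = refl
... | tri≈ _ αi≡αj _ = ⊥-elim-irr (Fin.<⇒≢ i<j
  (trans (sym (inverseˡ α)) (trans (cong (α ⟨$⟩ˡ_) αi≡αj) (inverseˡ α))))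
... | tri> _ _ _     = ⟪⟫-swap (β ⟨$⟩ʳ (α ⟨$⟩ʳ i)) (β ⟨$⟩ʳ (α ⟨$⟩ʳ j))

flip-cong : {α β : Permutation′ n} → α Perm.≈ β → flip α Perm.≈ flip β
flip-cong {α = α} {β} α≈β i = begin
  α ⟨$⟩ˡ i                      ≡⟨ cong (α ⟨$⟩ˡ_) (inverseʳ β) ⟨
  α ⟨$⟩ˡ (β ⟨$⟩ʳ (β ⟨$⟩ˡ i))    ≡⟨ cong (α ⟨$⟩ˡ_) (α≈β (β ⟨$⟩ˡ i)) ⟨
  α ⟨$⟩ˡ (α ⟨$⟩ʳ (β ⟨$⟩ˡ i))    ≡⟨ inverseˡ α ⟩
  β ⟨$⟩ˡ i                      ∎
  where open ≡-Reasoning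

·-congˡ : {α β : Permutation′ n} (G : Graph n) → α Perm.≈ β → α · G ≐ β · G
·-congˡ {α = α} {β} G α≈β e = cong G (image-cong {α = flip α} {flip β} (flip-cong {α = α} {β} α≈β) e)

-- `∘ₚ` applies its left argument first, hence the reversed order on the right.
·-∘ : (α β : Permutation′ n) (G : Graph n) → (α ∘ₚ β) · G ≐ β · α · G
·-∘ α β G e = cong G (image-∘ (flip β) (flip α) e)

module _ (S : Setoid 0ℓ 0ℓ) where

  open Setoid S using (Carrier; _≈_)
  open SetoidMembership S using () renaming (_∈_ to _∈ₛ_)

  lookup-injective : ∀ {xs} → Uniqueₛ.Unique S xs → ∀ i j → lookup xs i ≈ lookup xs j → i ≡ j
  lookup-injective (_  ∷ _)   zero    zero    _  = refl
  lookup-injective (x∉ ∷ _)   zero    (suc j) eq = contradiction eq (All.lookup x∉ (∈-lookup j))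
  lookup-injective (x∉ ∷ _)   (suc i) zero    eq =
    contradiction (Setoid.sym S eq) (All.lookup x∉ (∈-lookup i))
  lookup-injective (_  ∷ xs!) (suc i) (suc j) eq = cong suc (lookup-injective xs! i j eq)

  list-hasCardinality : ∀ {P : Pred Carrier 0ℓ} {xs} → Uniqueₛ.Unique S xs → All P xs →
                        (∀ {x} → P x → x ∈ₛ xs) → S ∣ P hasCardinality length xs
  list-hasCardinality {xs = xs} xs! Pxs P⇒∈ = record
    { to        = λ i → lookup xs i , All.lookup Pxs (∈-lookup i)
    ; cong      = λ { refl → Setoid.refl S }
    ; bijective = lookup-injective xs! _ _ ,
                  λ (x , Px) → index (P⇒∈ Px) , λ { refl → Setoid.sym S (lookup-index (P⇒∈ Px)) }
    }

-- One bijection followed by preimages under the other injects `Fin k` into `Fin l`, and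
-- symmetrically.
hasCardinality-unique : ∀ {S : Setoid 0ℓ 0ℓ} {k l} → S hasCardinality k → S hasCardinality l → k ≡ l
hasCardinality-unique {S} S≃k S≃l = ℕ.≤-antisym (bound S≃k S≃l) (bound S≃l S≃k)
  where
  bound : ∀ {k l} → S hasCardinality k → S hasCardinality l → k ≤ l
  bound f g = Fin.injective⇒≤ {f = λ i → proj₁ (g.strictlySurjective (f.to i))} λ {i} {j} eq →
    f.injective (S.trans (S.sym (proj₂ (g.strictlySurjective (f.to i))))
      (S.trans (g.cong eq) (proj₂ (g.strictlySurjective (f.to j)))))
    where
    module S = Setoid S
    module f = Bijection f
    module g = Bijection g

-- Following a complementing `α` by the inverse of the fixed `β` complements twice, so the result
-- fixes `G`.
coset-Γ : (G : Graph n) ((β , _) : SelfComplementary G) →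
          Bijection (permSetoid n ∣ λ α → α · G ≐ ∁ G) (Γ G)
coset-Γ G (β , βG≐∁G) = Inverse⇒Bijection record
  { to        = λ (α , αG≐∁G) → α ∘ₚ flip β , λ e →
      -- `flip β` acts by reading a graph at `image β e`, where `alternating` supplies the second
      -- negation.
      trans (·-∘ α (flip β) G e) (trans (αG≐∁G _) (trans (cong not (alternating e)) (Bool.not-involutive _)))
  ; from      = λ (γ , γG≐G) → γ ∘ₚ β , λ e →
      trans (·-∘ γ β G e) (trans (γG≐G _) (βG≐∁G e))
  ; to-cong   = λ eq i → cong (β ⟨$⟩ˡ_) (eq i)
  ; from-cong = λ eq i → cong (β ⟨$⟩ʳ_) (eq i)
  ; inverse   = (λ eq i → trans (cong (β ⟨$⟩ˡ_) (eq i)) (inverseˡ β))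
              , (λ eq i → trans (cong (β ⟨$⟩ʳ_) (eq i)) (inverseʳ β))
  }
  where
  alternating : Alternating β G
  alternating = ≐∁⇒alternating β βG≐∁G

complementing-complete : (G : Graph n) {α : Permutation′ n} → α · G ≐ ∁ G →
                         SetoidMembership._∈_ (permSetoid n) α (complementing G)
complementing-complete {n} G {α} αG≐∁G =
  Membershipₛ.∈-filter⁺ (permSetoid n) (_· G ≐∁?) (λ {α} {β} → ≐∁-resp-≈ G {α} {β}) {v = α}
    (Membershipₛ.∈-filter⁺ (permSetoid n) inA-S?
      (λ {α} {β} α≈β (H , sc , αH≐∁H) → H , sc , ≐∁-resp-≈ H {α} {β} α≈β αH≐∁H) {v = α}
      (permutations-complete n α) (G , (α , αG≐∁G) , αG≐∁G))
    αG≐∁G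
  where
  ≐∁-resp-≈ : ∀ (H : Graph n) {α β : Permutation′ n} → α Perm.≈ β → α · H ≐ ∁ H → β · H ≐ ∁ H
  ≐∁-resp-≈ H {α} {β} α≈β αH≐∁H e = trans (sym (·-congˡ {α = α} {β} H α≈β e)) (αH≐∁H e)

-- `d n (weight G)` counts the complementing permutations, and `coset-Γ` carries this count over to
-- the automorphisms.
Γ-hasCardinality : (G : Graph n) → SelfComplementary G → Γ G hasCardinality d n (weight G)
Γ-hasCardinality {n} G sc = subst (Γ G hasCardinality_) (sym (d-weight G)) (Compose.bijection
  (list-hasCardinality (permSetoid n)
    (Uniqueₛ.filter⁺ (permSetoid n) (_· G ≐∁?) (Uniqueₛ.filter⁺ (permSetoid n) inA-S? (permutations-unique n)))
    (All.all-filter (_· G ≐∁?) (A-S n))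
    (λ {α} → complementing-complete G {α}))
  (coset-Γ G sc))

-- ξ ≠ 0 makes every L ∈ 𝓛 n ξ the weight of a self-complementary graph.
𝓛-LSC : ∀ n ξ → ξ ≢ 0 → Bijection (𝓛 n ξ) (LSC n ξ)
𝓛-LSC n ξ ξ≢0 = record
  { to        = λ (L , dL≡ξ) → graph L dL≡ξ
  ; cong      = λ { {L , p} {_ , q} refl → weight-injective
                    (trans (weight-graph L p) (sym (weight-graph L q))) }
  ; bijective =
      (λ { {L , p} {L′ , q} G≐H →
           trans (sym (weight-graph L p)) (trans (weight-cong G≐H) (weight-graph L′ q)) })
    , λ (G , sc , Γ≃ξ) →
        (weight G , hasCardinality-unique (Γ-hasCardinality G sc) Γ≃ξ) ,
        λ { {L , p} refl → weight-injective (weight-graph L p) }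
  }
  where
  witness : ∀ L → d n L ≡ ξ → ∃ λ (G : Graph n) → SelfComplementary G × weight G ≡ L
  witness L dL≡ξ = d≢0⇒weight λ dL≡0 → ξ≢0 (trans (sym dL≡ξ) dL≡0)
  graph : ∀ L → d n L ≡ ξ → Setoid.Carrier (LSC n ξ)
  graph L dL≡ξ =
    let G , sc , eq = witness L dL≡ξ
    in G , sc , subst (Γ G hasCardinality_) (trans (cong (d n) eq) dL≡ξ) (Γ-hasCardinality G sc)
  weight-graph : ∀ L (p : d n L ≡ ξ) → weight (proj₁ (graph L p)) ≡ L
  weight-graph L p = proj₂ (proj₂ (witness L p))

-- As `ξ` is nonzero, every relevant exponent lies below `length (U n)`, so a finite search finds
-- them all.
𝓛-hasCardinality : ∀ n ξ → ξ ≢ 0 →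
                   𝓛 n ξ hasCardinality length (filter (λ L → d n L ℕ.≟ ξ) (upTo (length (U n))))
𝓛-hasCardinality n ξ ξ≢0 = list-hasCardinality (setoid ℕ)
  (Unique.filter⁺ d≟ξ (Unique.upTo⁺ (length (U n))))
  (All.all-filter d≟ξ (upTo (length (U n))))
  (λ {L} dL≡ξ → ∈-filter⁺ d≟ξ
    (∈-upTo⁺ (coeff-bound (U n) L λ dL≡0 → ξ≢0 (trans (sym dL≡ξ) dL≡0))) dL≡ξ)
  where
  d≟ξ : Decidable (λ L → d n L ≡ ξ)
  d≟ξ L = d n L ℕ.≟ ξ

theorem11 : ∀ n → 4 ≤ n → n % 4 ≡ 0 ⊎ n % 4 ≡ 1 →
    ∀ ξ → ξ ∈ 𝓓 n →
    ∃ λ lsc → LSC n ξ hasCardinality lsc × 𝓛 n ξ hasCardinality lsc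
theorem11 n _ _ ξ (L , dL≢0 , ξ≡dL) =
  _ , Compose.bijection (𝓛-hasCardinality n ξ ξ≢0) (𝓛-LSC n ξ ξ≢0) , 𝓛-hasCardinality n ξ ξ≢0
  where
  ξ≢0 : ξ ≢ 0
  ξ≢0 ξ≡0 = dL≢0 (trans (sym ξ≡dL) ξ≡0)
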